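{- Let $\mathcal{F}$ be a class of simple graphs closed under subdivisions. Then $\mathcal{F}\subseteq\mathrm{cl}(\mathcal{F}_K)$ for every non-bipartite graph $K$. In particular, $\equiv_{\mathcal{F}}$ admits $K$-cancellation for every non-bipartite graph $K$.
   Context: All graphs are finite, undirected, without multiple edges; simple means without loops. $\hom(F,G)$ counts homomorphisms; $G\equiv_{\mathcal{F}}H$ means $\hom(F,G)=\hom(F,H)$ for all $F\in\mathcal{F}$; $\mathrm{cl}(\mathcal{F})$ is the class of simple graphs $L$ such that for all simple $G,H$, $G\equiv_{\mathcal{F}}H$ implies $\hom(L,G)=\hom(L,H)$. $\mathcal{F}_K=\{F\in\mathcal{F}\mid\hom(F,K)>0\}$. A class is closed under subdivisions if replacing any edge of a member by a path yields a member. $G\times K$ is the categorical product (vertex set $V(G)\times V(K)$, $(g,k)\sim(g',k')$ iff $gg'\in E(G)$ and $kk'\in E(K)$). An equivalence relation $\approx$ on graphs admits $K$-cancellation if $G\times K\approx H\times K$ implies $G\approx H$ for all graphs $G,H$. -}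

module Defs where

open import Data.Bool.Base using (Bool)
open import Data.Fin.Base using (Fin; zero; fromℕ; toℕ; splitAt; remQuot; finToFun)
open import Data.Fin.Properties using (_≟_; all?)
open import Data.List.Base using (allFin; filter; length)
open import Data.Nat.Base using (ℕ; suc; _+_; _*_; _^_; _>_)
import Data.Nat.Properties as ℕ
open import Data.Product.Base using (_×_; _,_; ∃)
open import Data.Product.Relation.Binary.Pointwise.NonDependent
  using (Pointwise; ×-decidable)
open import Data.Sum.Base using (_⊎_; inj₁; inj₂) renaming (swap to ⊎-swap)
open import Function.Base using (_∘_; _on_)
open import Level using (Level; 0ℓ; _⊔_) renaming (suc to lsuc)
open import Relation.Binary.Core using (Rel)
open import Relation.Binary.Definitions using (Symmetric; Decidable; Irreflexive)
open import Relation.Binary.PropositionalEquality.Core using (_≡_; _≢_; refl; sym; trans)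
open import Relation.Binary.Structures using (IsEquivalence)
import Relation.Binary.Construct.On as On
open import Relation.Nullary.Decidable using (Dec; _×-dec_; _⊎-dec_; _→-dec_; ¬?)
open import Relation.Nullary.Negation.Core using (¬_)
open import Relation.Unary using (Pred)

private
  variable
    ℓ : Level

-- Finite undirected graphs without multiple edges; loops are allowed.
record Graph : Set₁ where
  field
    order : ℕ
  Vertex : Set
  Vertex = Fin order
  field
    _~_   : Rel Vertex 0ℓ
    ~-sym : Symmetric _~_
    _~?_  : Decidable _~_

open Graph using (order; Vertex)

Simple : Pred Graph 0ℓ
Simple G = Irreflexive _≡_ (Graph._~_ G)

-- A graph with a loop is never bipartite.
Bipartite : Pred Graph 0ℓ
Bipartite G = ∃ λ (side : Vertex G → Bool) → ∀ {u v} → u ~ v → side u ≢ side v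
  where open Graph G using (_~_)

------------------------------------------------------------------------
-- Homomorphism counts

IsHom : (F G : Graph) → Pred (Vertex F → Vertex G) 0ℓ
IsHom F G f = ∀ u v → u F.~ v → f u G.~ f v
  where
  module F = Graph F
  module G = Graph G

isHom? : (F G : Graph) (f : Vertex F → Vertex G) → Dec (IsHom F G f)
isHom? F G f = all? λ u → all? λ v → (u F.~? v) →-dec (f u G.~? f v)
  where
  module F = Graph F
  module G = Graph G

-- finToFun enumerates the maps Vertex F → Vertex G, each exactly once.
hom : Graph → Graph → ℕ
hom F G = length (filter (isHom? F G ∘ finToFun) (allFin (order G ^ order F)))

HomEquiv : Pred Graph ℓ → Rel Graph (lsuc 0ℓ ⊔ ℓ)
HomEquiv 𝓕 G H = ∀ F → 𝓕 F → hom F G ≡ hom F H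

HomEquiv-isEquivalence : (𝓕 : Pred Graph ℓ) → IsEquivalence (HomEquiv 𝓕)
HomEquiv-isEquivalence 𝓕 = record
  { refl  = λ _ _ → refl
  ; sym   = λ G≡H F F∈𝓕 → sym (G≡H F F∈𝓕)
  ; trans = λ G≡H H≡I F F∈𝓕 → trans (G≡H F F∈𝓕) (H≡I F F∈𝓕)
  }

cl : Pred Graph ℓ → Pred Graph (lsuc 0ℓ ⊔ ℓ)
cl 𝓕 L = Simple L ×
  (∀ G H → Simple G → Simple H → HomEquiv 𝓕 G H → hom L G ≡ hom L H)

-- The class 𝓕_K.
_↓_ : Pred Graph ℓ → Graph → Pred Graph ℓ
(𝓕 ↓ K) F = 𝓕 F × hom F K > 0

------------------------------------------------------------------------
-- Subdivisions

module _ (F : Graph) (u v : Vertex F) (m : ℕ) where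
  open Graph F using (_~_; ~-sym; _~?_)

  -- Vertices inj₁ a are those of F; the inj₂ i are the inner vertices, in
  -- order, of the new path from u to v.
  PathEnd : Vertex F → Fin (suc m) → Set
  PathEnd a i = (a ≡ u × i ≡ zero) ⊎ (a ≡ v × i ≡ fromℕ m)

  SubdivisionEdge : Rel (Vertex F ⊎ Fin (suc m)) 0ℓ
  SubdivisionEdge (inj₁ a) (inj₁ b) = a ~ b × ¬ (a ≡ u × b ≡ v) × ¬ (b ≡ u × a ≡ v)
  SubdivisionEdge (inj₁ a) (inj₂ j) = PathEnd a j
  SubdivisionEdge (inj₂ i) (inj₁ b) = PathEnd b i
  SubdivisionEdge (inj₂ i) (inj₂ j) = toℕ j ≡ suc (toℕ i) ⊎ toℕ i ≡ suc (toℕ j)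

  private
    edge-sym : Symmetric SubdivisionEdge
    edge-sym {inj₁ a} {inj₁ b} (a~b , p , q) = ~-sym a~b , q , p
    edge-sym {inj₁ a} {inj₂ j} e = e
    edge-sym {inj₂ i} {inj₁ b} e = e
    edge-sym {inj₂ i} {inj₂ j} e = ⊎-swap e

    end? : Decidable PathEnd
    end? a i = (a ≟ u ×-dec i ≟ zero) ⊎-dec (a ≟ v ×-dec i ≟ fromℕ m)

    edge? : Decidable SubdivisionEdge
    edge? (inj₁ a) (inj₁ b) =
      (a ~? b) ×-dec ¬? (a ≟ u ×-dec b ≟ v) ×-dec ¬? (b ≟ u ×-dec a ≟ v)
    edge? (inj₁ a) (inj₂ j) = end? a j
    edge? (inj₂ i) (inj₁ b) = end? b i
    edge? (inj₂ i) (inj₂ j) =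
      (toℕ j ℕ.≟ suc (toℕ i)) ⊎-dec (toℕ i ℕ.≟ suc (toℕ j))

  -- The edge uv is replaced by a path with suc m inner vertices, i.e. of
  -- length m + 2. (A path of length one would leave F unchanged.)
  -- Only meaningful when u ~ v.
  subdivide : Graph
  subdivide = record
    { order = order F + suc m
    ; _~_   = SubdivisionEdge on splitAt (order F)
    ; ~-sym = λ {x} {y} → edge-sym {splitAt (order F) x} {splitAt (order F) y}
    ; _~?_  = On.decidable (splitAt (order F)) SubdivisionEdge edge?
    }

-- Invariance of 𝓕 under isomorphism is not imposed.
ClosedUnderSubdivisions : Pred Graph ℓ → Set (lsuc 0ℓ ⊔ ℓ)
ClosedUnderSubdivisions 𝓕 =
  ∀ F → 𝓕 F → ∀ u v → Graph._~_ F u v → ∀ m → 𝓕 (subdivide F u v m)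

------------------------------------------------------------------------
-- Categorical product and cancellation

-- remQuot is the bijection Fin (m * n) → Fin m × Fin n.
_⊗_ : Graph → Graph → Graph
G ⊗ K = record
  { order = order G * order K
  ; _~_   = Pointwise G._~_ K._~_ on remQuot (order K)
  ; ~-sym = λ (g~g′ , k~k′) → G.~-sym g~g′ , K.~-sym k~k′
  ; _~?_  = On.decidable (remQuot (order K)) _ (×-decidable G._~?_ K._~?_)
  }
  where
  module G = Graph G
  module K = Graph K

-- G and H range over all graphs, with or without loops.
AdmitsCancellation : Rel Graph ℓ → Graph → Set (lsuc 0ℓ ⊔ ℓ)
AdmitsCancellation _≈_ K = ∀ G H → (G ⊗ K) ≈ (H ⊗ K) → G ≈ H

{-# OPTIONS --safe #-}
module Submission where

-- Replace an edge uv of F by a path of length k.  Then hom(–, G) becomes a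
-- linear functional of the k-th power of the adjacency matrix A of G.  The
-- powers of A satisfy a linear recurrence, and as A is symmetric, A²X = 0 forces
-- AX = 0, so the recurrence may be taken to start with a nonzero coefficient at
-- the first power; one recurrence serves G and H alike.  Hence if all long
-- subdivisions of uv have equal counts in G and H, running the recurrence
-- backwards to k = 1 shows that F has.  A non-bipartite K has closed walks at
-- some vertex x of every large enough length, so once all edges of F are
-- subdivided by long paths there is a homomorphism to K sending all vertices of
-- F to x, and the counts agree by assumption; the subdivisions are then undone
-- one edge at a time.  Cancellation follows, as hom(F, G × K) = hom(F, G) hom(F, K).

open import Defs

import Algebra.Properties.AbelianGroup as AbelianGroup
import Algebra.Properties.Semiring.Sum as Sum
open import Data.Bool.Base using (Bool; true; false; not; _xor_; if_then_else_)
import Data.Bool.Properties as Bool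
open import Data.Fin.Base using (Fin; zero; suc; toℕ; fromℕ; splitAt; join; remQuot; combine;
  finToFun; funToFin; punchIn; _↑ˡ_; _↑ʳ_)
open import Data.Fin.Properties using (_≟_; any?; splitAt-↑ˡ; splitAt-↑ʳ; splitAt⁻¹-↑ˡ;
  splitAt-join; remQuot-combine; finToFun-funToFin)
open import Data.Integer.Base as ℤ using (ℤ; +_; 0ℤ; 1ℤ; _+_; _*_; -_; _-_)
import Data.Integer.Properties as ℤ
open import Data.Integer.Tactic.RingSolver using (solve-∀)
open import Data.List.Base using (List; []; _∷_; length; filter; tabulate; allFin; cartesianProduct)
open import Data.List.Membership.Propositional using (_∈_)
open import Data.List.Membership.Propositional.Properties
  using (∈-allFin; ∈-cartesianProduct⁺; ∈-filter⁺; ∈-length)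
open import Data.List.Relation.Unary.Any using (here; there)
open import Data.Nat.Base as ℕ using (ℕ; zero; suc; _>_)
import Data.Nat.Properties as ℕ
open import Data.Product.Base using (_×_; _,_; ∃; ∃₂; proj₁; proj₂; uncurry)
open import Data.Sum.Base using (_⊎_; inj₁; inj₂; [_,_]′)
open import Data.Vec.Base as Vec using (Vec; []; _∷_)
open import Data.Vec.Functional as Vector using (_++_; tail; insertAt)
open import Data.Vec.Functional.Properties using (insertAt-lookup; insertAt-punchIn)
open import Data.Vec.Membership.Propositional using () renaming (_∈_ to _∈ᵛ_)
open import Data.Vec.Membership.Propositional.Properties using (∈-fromList⁺)
  renaming (∈-map⁺ to ∈ᵛ-map⁺)
open import Data.Vec.Relation.Unary.All as VecAll using ([]; _∷_)
open import Data.Vec.Relation.Unary.All.Properties using (map⁺)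
open import Data.Vec.Relation.Unary.Any using (here; there)
open import Function.Base using (_∘_; id)
open import Level using (Level; 0ℓ)
open import Relation.Binary.PropositionalEquality hiding ([_])
open import Relation.Nullary.Decidable using (Dec; yes; no; does; ¬?; _×-dec_; decidable-stable)
open import Relation.Nullary.Negation.Core using (¬_; contradiction)
open import Relation.Unary using (Pred; Decidable; _⊆_)

open AbelianGroup ℤ.+-0-abelianGroup using (∙-cancelʳ)
open Sum ℤ.+-*-semiring
open Graph using (order; Vertex)
open ≡-Reasoning

-- Linear recurrences for powers of symmetric matrices

sum-zero : ∀ {n} (f : Fin n → ℤ) → (∀ i → f i ≡ 0ℤ) → sum f ≡ 0ℤ
sum-zero {n} f f≡0 = trans (sum-cong-≗ f≡0) (sum-replicate-zero n)

*-cancel-0 : ∀ {i j} → i ≢ 0ℤ → i * j ≡ 0ℤ → j ≡ 0ℤ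
*-cancel-0 {i} {j} i≢0 ij≡0 with ℤ.i*j≡0⇒i≡0∨j≡0 i ij≡0
... | inj₁ i≡0 = contradiction i≡0 i≢0
... | inj₂ j≡0 = j≡0

-- Fraction-free Gaussian elimination, by induction on the dimension: cross-multiplying with a pivot
-- clears the first coordinate of the other vectors without division.
linear-dependence : ∀ n (v : Fin (suc n) → Fin n → ℤ) →
  ∃ λ (c : Fin (suc n) → ℤ) → (∃ λ i → c i ≢ 0ℤ) × (∀ j → ∑[ i < suc n ] (c i * v i j) ≡ 0ℤ)
linear-dependence zero v = (λ _ → 1ℤ) , (zero , λ ()) , λ ()
linear-dependence (suc n) v with any? (λ i → ¬? (v i zero ℤ.≟ 0ℤ))
-- Every first coordinate is zero, so the first vector gets coefficient 0 and the induction ignores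
-- that coordinate.
... | no none =
  let c , (i , cᵢ≢0) , c-dep = linear-dependence n (λ i j → v (suc i) (suc j))
      v-zero : ∀ i → v i zero ≡ 0ℤ
      v-zero i = decidable-stable (v i zero ℤ.≟ 0ℤ) λ v≢0 → none (i , v≢0)
  in insertAt c zero 0ℤ , (suc i , cᵢ≢0) , λ where
    zero    → sum-zero _ λ i →
      trans (cong (insertAt c zero 0ℤ i *_) (v-zero i)) (ℤ.*-zeroʳ (insertAt c zero 0ℤ i))
    (suc j) → trans (ℤ.+-identityˡ _) (c-dep j)
... | yes (p , a≢0) = c , (punchIn p i , c≢0) , c-dep
  where
  a = v p zero
  v′ = λ i → v (punchIn p i)

  reduced : Fin (suc n) → Fin (suc n) → ℤ
  reduced i j = a * v′ i j - v′ i zero * v p j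

  ih = linear-dependence n (λ i j → reduced i (suc j))
  d = proj₁ ih
  i = proj₁ (proj₁ (proj₂ ih))

  -- The coefficients `d` of the reduced vectors, expanded in the original ones: `d i * a` on the
  -- others and the collected remainder `cₚ` on the pivot. As `a` is nonzero, a nonzero `d i` stays
  -- nonzero.
  cₚ = ∑[ i < suc n ] (- (d i * v′ i zero))
  da : Fin (suc n) → ℤ
  da i = d i * a
  c = insertAt da p cₚ

  c≢0 : c (punchIn p i) ≢ 0ℤ
  c≢0 cᵢ≡0 = a≢0 (*-cancel-0 (proj₂ (proj₁ (proj₂ ih)))
    (trans (sym (insertAt-punchIn da p cₚ i)) cᵢ≡0))

  regroup : ∀ d a b x y → - (d * b) * y + d * a * x ≡ d * (a * x - b * y)
  regroup = solve-∀

  eliminate : ∀ j → ∑[ i < suc (suc n) ] (c i * v i j) ≡ ∑[ i < suc n ] (d i * reduced i j)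
  eliminate j = begin
    ∑[ i < suc (suc n) ] (c i * v i j)
      ≡⟨ sum-remove {i = p} (λ i → c i * v i j) ⟩
    c p * v p j + ∑[ i < suc n ] (c (punchIn p i) * v′ i j)
      ≡⟨ cong₂ _+_ (cong (_* v p j) (insertAt-lookup da p cₚ))
           (sum-cong-≗ λ i → cong (_* v′ i j) (insertAt-punchIn da p cₚ i)) ⟩
    cₚ * v p j + ∑[ i < suc n ] (d i * a * v′ i j)
      ≡⟨ cong (_+ ∑[ i < suc n ] (da i * v′ i j)) (*-distribʳ-sum (v p j) (λ i → - (d i * v′ i zero))) ⟩
    ∑[ i < suc n ] (- (d i * v′ i zero) * v p j) + ∑[ i < suc n ] (d i * a * v′ i j)
      ≡⟨ ∑-distrib-+ (λ i → - (d i * v′ i zero) * v p j) (λ i → d i * a * v′ i j) ⟨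
    ∑[ i < suc n ] (- (d i * v′ i zero) * v p j + d i * a * v′ i j)
      ≡⟨ sum-cong-≗ (λ i → regroup (d i) a (v′ i zero) (v′ i j) (v p j)) ⟩
    ∑[ i < suc n ] (d i * reduced i j) ∎

  cancel : ∀ d a b → d * (a * b - b * a) ≡ 0ℤ
  cancel = solve-∀

  c-dep : ∀ j → ∑[ i < suc (suc n) ] (c i * v i j) ≡ 0ℤ
  c-dep zero    = trans (eliminate zero)
    (sum-zero _ λ i → cancel (d i) a (v′ i zero))
  c-dep (suc j) = trans (eliminate (suc j)) (proj₂ (proj₂ ih) j)

-- The polynomial `c` in the shift operator, applied to `f` and read at `k`. It vanishes for all `k`
-- exactly when `f` satisfies the recurrence with coefficients `c`, lowest first.
window : ∀ {N} → (Fin N → ℤ) → (ℕ → ℤ) → ℕ → ℤ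
window {N} c f k = ∑[ i < N ] (c i * f (toℕ i ℕ.+ k))

window-cong : ∀ {N} (c : Fin N → ℤ) {f g : ℕ → ℤ} → f ≗ g → window c f ≗ window c g
window-cong c f≗g k = sum-cong-≗ λ i → cong (c i *_) (f≗g (toℕ i ℕ.+ k))

window-shift : ∀ {N} (c : Fin N → ℤ) f k → window c (f ∘ suc) k ≡ window c f (suc k)
window-shift c f k = sum-cong-≗ λ i → cong (λ m → c i * f m) (sym (ℕ.+-suc (toℕ i) k))

window-sum : ∀ {N n} (c : Fin N → ℤ) (f : Fin n → ℕ → ℤ) k →
  window c (λ m → ∑[ z < n ] f z m) k ≡ ∑[ z < n ] window c (f z) k
window-sum {N} {n} c f k = trans
  (sum-cong-≗ λ i → *-distribˡ-sum (c i) (λ z → f z (toℕ i ℕ.+ k)))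
  (∑-comm (λ i z → c i * f z (toℕ i ℕ.+ k)))

window-* : ∀ {N} (c : Fin N → ℤ) w f k → window c (λ m → w * f m) k ≡ w * window c f k
window-* c w f k = trans
  (sum-cong-≗ λ i → swap (c i) w (f (toℕ i ℕ.+ k)))
  (sym (*-distribˡ-sum w (λ i → c i * f (toℕ i ℕ.+ k))))
  where
  swap : ∀ a b x → a * (b * x) ≡ b * (a * x)
  swap = solve-∀

-- A vanishing lowest coefficient is removed at the cost of starting one place later; some
-- coefficient is nonzero, so this stops. The relation is shared by the whole family `f`.
drop-leading-zeros : ∀ {I : Set} (f : I → ℕ → ℤ) {N} (c : Fin N → ℤ) → (∃ λ i → c i ≢ 0ℤ) →
  ∀ k → (∀ t → window c (f t) k ≡ 0ℤ) →
  ∃ λ M → ∃ λ (d : Fin (suc M) → ℤ) → d zero ≢ 0ℤ × ∃ λ m → ∀ t → window d (f t) m ≡ 0ℤ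
drop-leading-zeros f {suc N} c (i , cᵢ≢0) k c-rel with c zero ℤ.≟ 0ℤ
... | no c₀≢0 = N , c , c₀≢0 , k , c-rel
drop-leading-zeros f c (zero , c₀≢0) k c-rel | yes c₀≡0 = contradiction c₀≡0 c₀≢0
drop-leading-zeros f c (suc i , cᵢ≢0) k c-rel | yes c₀≡0 =
  drop-leading-zeros f (c ∘ suc) (i , cᵢ≢0) (suc k) λ t → begin
    window (c ∘ suc) (f t) (suc k)
      ≡⟨ window-shift (c ∘ suc) (f t) k ⟨
    window (c ∘ suc) (f t ∘ suc) k
      ≡⟨ ℤ.+-identityˡ _ ⟨
    0ℤ * f t k + window (c ∘ suc) (f t ∘ suc) k
      ≡⟨ cong (λ z → z * f t k + window (c ∘ suc) (f t ∘ suc) k) c₀≡0 ⟨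
    window c (f t) k
      ≡⟨ c-rel t ⟩
    0ℤ ∎

-- The recurrence can be run backwards because its lowest coefficient is nonzero.
recurrence-backwards : ∀ {N} (c : Fin (suc N) → ℤ) → c zero ≢ 0ℤ →
  ∀ (f g : ℕ → ℤ) → window c f ≗ window c g →
  ∀ M → (∀ m → f (m ℕ.+ M) ≡ g (m ℕ.+ M)) → f 0 ≡ g 0
recurrence-backwards c c₀≢0 f g rec zero    f≡g = f≡g 0
recurrence-backwards c c₀≢0 f g rec (suc M) f≡g = recurrence-backwards c c₀≢0 f g rec M λ where
    -- In the relation at `M` all terms beyond `M` already agree; cancelling them and then `c zero`
    -- leaves `f M ≡ g M`.
    zero    → ℤ.*-cancelˡ-≡ (c zero) (f M) (g M) {{ℤ.≢-nonZero c₀≢0}}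
                (∙-cancelʳ (window (c ∘ suc) (g ∘ suc) M) (c zero * f M) (c zero * g M) (begin
      c zero * f M + window (c ∘ suc) (g ∘ suc) M
        ≡⟨ cong (λ z → c zero * f M + z) (sum-cong-≗ λ i → cong (c (suc i) *_) (f≡g′ (toℕ i))) ⟨
      window c f M
        ≡⟨ rec M ⟩
      window c g M ∎))
    (suc m) → f≡g′ m
  where
  f≡g′ : ∀ m → f (suc m ℕ.+ M) ≡ g (suc m ℕ.+ M)
  f≡g′ m = subst (λ k → f k ≡ g k) (ℕ.+-suc m M) (f≡g m)

-- Producing the sum as a natural number `s` makes positivity available: in ℕ a sum is zero only if
-- both summands are.
sum-squares : ∀ {n} (u : Fin n → ℤ) →
  ∃ λ s → ∑[ x < n ] (u x * u x) ≡ + s × (s ≡ 0 → ∀ x → u x ≡ 0ℤ)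
sum-squares {zero}  u = 0 , refl , λ _ ()
sum-squares {suc n} u =
  let s , eq , s≡0⇒ = sum-squares (u ∘ suc)
      a = ℤ.∣ u zero ∣ in
  a ℕ.* a ℕ.+ s ,
  trans (cong₂ _+_ (square (u zero)) eq) (sym (ℤ.pos-+ (a ℕ.* a) s)) ,
  λ where
    e zero    → ℤ.∣i∣≡0⇒i≡0 (root a (ℕ.m+n≡0⇒m≡0 (a ℕ.* a) e))
    e (suc x) → s≡0⇒ (ℕ.m+n≡0⇒n≡0 (a ℕ.* a) e) x
  where
  square : ∀ i → i * i ≡ + (ℤ.∣ i ∣ ℕ.* ℤ.∣ i ∣)
  square (+ m)      = sym (ℤ.pos-* m m)
  square ℤ.-[1+ m ] = refl

  root : ∀ a → a ℕ.* a ≡ 0 → a ≡ 0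
  root zero _ = refl

sum-squares≡0 : ∀ {n} (u : Fin n → ℤ) → ∑[ x < n ] (u x * u x) ≡ 0ℤ → ∀ x → u x ≡ 0ℤ
sum-squares≡0 u e = let s , eq , s≡0⇒ = sum-squares u in
  s≡0⇒ (ℤ.+-injective (trans (sym eq) e))

δ : ∀ {n} → Fin n → Fin n → ℤ
δ x y = if does (x ≟ y) then 1ℤ else 0ℤ

sum-δ : ∀ {n} (f : Fin n → ℤ) y → ∑[ z < n ] (f z * δ z y) ≡ f y
sum-δ f zero = trans
  (cong₂ _+_ (ℤ.*-identityʳ (f zero)) (sum-zero _ λ z → ℤ.*-zeroʳ (f (suc z))))
  (ℤ.+-identityʳ (f zero))
sum-δ f (suc y) = trans
  (cong₂ _+_ (ℤ.*-zeroʳ (f zero)) (sum-δ (f ∘ suc) y))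
  (ℤ.+-identityˡ (f (suc y)))

power : ∀ {n} → (Fin n → Fin n → ℤ) → ℕ → Fin n → Fin n → ℤ
power A zero    x y = δ x y
power {n} A (suc k) x y = ∑[ z < n ] (A x z * power A k z y)

module _ {n} (A : Fin n → Fin n → ℤ) (A-sym : ∀ x y → A x y ≡ A y x) where

  private
    apply : (Fin n → ℤ) → Fin n → ℤ
    apply u x = ∑[ z < n ] (A x z * u z)

    apply-zero : ∀ u → (∀ x → u x ≡ 0ℤ) → ∀ x → apply u x ≡ 0ℤ
    apply-zero u u≡0 x = sum-zero _ λ z →
      trans (cong (A x z *_) (u≡0 z)) (ℤ.*-zeroʳ (A x z))

    rearrange : ∀ a b c → a * (b * c) ≡ c * (b * a)
    rearrange = solve-∀

    -- |Au|² = ⟨u, A²u⟩ as A is symmetric.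
    apply²≡0⇒apply≡0 : ∀ u → (∀ x → apply (apply u) x ≡ 0ℤ) → ∀ x → apply u x ≡ 0ℤ
    apply²≡0⇒apply≡0 u A²u≡0 = sum-squares≡0 (apply u) (begin
      ∑[ x < n ] (apply u x * apply u x)
        ≡⟨ sum-cong-≗ (λ x → *-distribˡ-sum (apply u x) (λ z → A x z * u z)) ⟩
      ∑[ x < n ] ∑[ z < n ] (apply u x * (A x z * u z))
        ≡⟨ ∑-comm (λ x z → apply u x * (A x z * u z)) ⟩
      ∑[ z < n ] ∑[ x < n ] (apply u x * (A x z * u z))
        ≡⟨ sum-cong-≗ (λ z → sum-cong-≗ λ x → trans
             (cong (λ a → apply u x * (a * u z)) (A-sym x z))
             (rearrange (apply u x) (A z x) (u z))) ⟩
      ∑[ z < n ] ∑[ x < n ] (u z * (A z x * apply u x))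
        ≡⟨ sum-cong-≗ (λ z → *-distribˡ-sum (u z) (λ x → A z x * apply u x)) ⟨
      ∑[ z < n ] (u z * apply (apply u) z)
        ≡⟨ sum-zero _ (λ z → trans (cong (u z *_) (A²u≡0 z)) (ℤ.*-zeroʳ (u z))) ⟩
      0ℤ ∎)

  -- A relation at a single shift `s` spreads to every positive shift: upwards by multiplying with
  -- `A`, downwards by cancelling a factor `A` while another one remains.
  power-recurrence : ∀ {N} (c : Fin N → ℤ) s →
    (∀ x y → window c (λ m → power A m x y) s ≡ 0ℤ) →
    ∀ k x y → window c (λ m → power A (suc m) x y) k ≡ 0ℤ
  power-recurrence {N} c s rel k x y = trans (window-shift c (λ m → power A m x y) k) (upward k x)
    where
    -- With `p` the polynomial with coefficients `c`, this is column `y` of `A^k p(A)`.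
    u : ℕ → Fin n → ℤ
    u k x = window c (λ m → power A m x y) k

    u-suc : ∀ k x → u (suc k) x ≡ apply (u k) x
    u-suc k x = trans (sym (window-shift c (λ m → power A m x y) k))
      (trans (window-sum c (λ z m → A x z * power A m z y) k)
        (sum-cong-≗ λ z → window-* c (A x z) (λ m → power A m z y) k))

    u≡0 : ∀ k → (∀ x → u k x ≡ 0ℤ) → ∀ x → u (suc k) x ≡ 0ℤ
    u≡0 k uₖ≡0 x = trans (u-suc k x) (apply-zero (u k) uₖ≡0 x)

    downward : ∀ s → (∀ x → u s x ≡ 0ℤ) → ∀ x → u 1 x ≡ 0ℤ
    downward zero          uₛ≡0 = u≡0 0 uₛ≡0
    -- The descent ends at shift 1, not 0, because `A` may be singular.
    downward (suc zero)    uₛ≡0 = uₛ≡0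
    downward (suc (suc s)) uₛ≡0 = downward (suc s) λ x →
      trans (u-suc s x) (apply²≡0⇒apply≡0 (u s) (λ x → begin
        apply (apply (u s)) x  ≡⟨ sum-cong-≗ (λ z → cong (A x z *_) (u-suc s z)) ⟨
        apply (u (suc s)) x    ≡⟨ u-suc (suc s) x ⟨
        u (suc (suc s)) x      ≡⟨ uₛ≡0 x ⟩
        0ℤ                     ∎) x)

    upward : ∀ k x → u (suc k) x ≡ 0ℤ
    upward zero    = downward s (λ x → rel x y)
    upward (suc k) = u≡0 (suc k) (upward k)

-- All entries of `A^k` and `B^k` together form one vector of dimension `D`. The vectors for `k`
-- from 0 to `D` are linearly dependent, which gives one relation valid in every entry of both
-- matrices.
common-recurrence : ∀ {m n} (A : Fin m → Fin m → ℤ) (B : Fin n → Fin n → ℤ) →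
  (∀ x y → A x y ≡ A y x) → (∀ x y → B x y ≡ B y x) →
  ∃ λ N → ∃ λ (c : Fin (suc N) → ℤ) → c zero ≢ 0ℤ ×
    (∀ k x y → window c (λ m → power A (suc m) x y) k ≡ 0ℤ) ×
    (∀ k x y → window c (λ m → power B (suc m) x y) k ≡ 0ℤ)
common-recurrence {m} {n} A B A-sym B-sym =
  let N , c , c₀≢0 , s , rel = drop-leading-zeros entry (proj₁ dep) (proj₁ (proj₂ dep)) 0 λ t →
        trans (sum-cong-≗ λ i → cong (λ k → proj₁ dep i * entry t k) (ℕ.+-identityʳ (toℕ i)))
          (proj₂ (proj₂ dep) t)
  in N , c , c₀≢0 ,
    power-recurrence A A-sym c s (λ x y → trans
      (window-cong c (λ k → sym (entry-A k x y)) s) (rel (combine x y ↑ˡ (n ℕ.* n)))) ,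
    power-recurrence B B-sym c s (λ x y → trans
      (window-cong c (λ k → sym (entry-B k x y)) s) (rel ((m ℕ.* m) ↑ʳ combine x y)))
  where
  D = m ℕ.* m ℕ.+ n ℕ.* n

  entry : Fin D → ℕ → ℤ
  entry t k = [ (λ p → uncurry (power A k) (remQuot m p))
              , (λ p → uncurry (power B k) (remQuot n p)) ]′ (splitAt (m ℕ.* m) t)

  entry-A : ∀ k x y → entry (combine x y ↑ˡ (n ℕ.* n)) k ≡ power A k x y
  entry-A k x y rewrite splitAt-↑ˡ (m ℕ.* m) (combine x y) (n ℕ.* n) =
    cong (uncurry (power A k)) (remQuot-combine x y)

  entry-B : ∀ k x y → entry ((m ℕ.* m) ↑ʳ combine x y) k ≡ power B k x y
  entry-B k x y rewrite splitAt-↑ʳ (m ℕ.* m) (n ℕ.* n) (combine x y) =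
    cong (uncurry (power B k)) (remQuot-combine x y)

  dep = linear-dependence D λ i t → entry t (toℕ i)

-- Homomorphism counts as sums over maps

indicator : ∀ {p} {P : Set p} → Dec P → ℤ
indicator p? = if does p? then 1ℤ else 0ℤ

indicator-cong : ∀ {p q} {P : Set p} {Q : Set q} (p? : Dec P) (q? : Dec Q) →
  (P → Q) → (Q → P) → indicator p? ≡ indicator q?
indicator-cong (yes _) (yes _) _   _   = refl
indicator-cong (yes p) (no ¬q) p⇒q _   = contradiction (p⇒q p) ¬q
indicator-cong (no ¬p) (yes q) _   q⇒p = contradiction (q⇒p q) ¬p
indicator-cong (no _)  (no _)  _   _   = refl

indicator-× : ∀ {p q} {P : Set p} {Q : Set q} (p? : Dec P) (q? : Dec Q) →
  indicator (p? ×-dec q?) ≡ indicator p? * indicator q?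
indicator-× p? q? with does p? | does q?
... | true  | true  = refl
... | true  | false = refl
... | false | _     = refl

count-sum : ∀ {A : Set} {P : Pred A 0ℓ} (P? : Decidable P) {n} (f : Fin n → A) →
  + length (filter P? (tabulate f)) ≡ ∑[ i < n ] indicator (P? (f i))
count-sum P? {zero}  f = refl
count-sum P? {suc n} f with does (P? (f zero))
... | true  = cong (λ z → 1ℤ + z) (count-sum P? (f ∘ suc))
... | false = trans (count-sum P? (f ∘ suc)) (sym (ℤ.+-identityˡ (∑[ i < n ] indicator (P? (f (suc i))))))

sum-++ : ∀ m {n} (f : Fin (m ℕ.+ n) → ℤ) →
  sum f ≡ ∑[ i < m ] f (i ↑ˡ n) + ∑[ j < n ] f (m ↑ʳ j)
sum-++ zero    f = sym (ℤ.+-identityˡ (sum f))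
sum-++ (suc m) {n} f = trans (cong (λ z → f zero + z) (sum-++ m (f ∘ suc)))
  (sym (ℤ.+-assoc (f zero) (∑[ i < m ] f (suc i ↑ˡ n)) (∑[ j < n ] f (suc m ↑ʳ j))))

sum-combine : ∀ m {n} (f : Fin (m ℕ.* n) → ℤ) →
  sum f ≡ ∑[ i < m ] ∑[ j < n ] f (combine i j)
sum-combine zero    f = refl
sum-combine (suc m) {n} f = trans (sum-++ n f)
  (cong (λ z → ∑[ j < n ] f (j ↑ˡ (m ℕ.* n)) + z) (sum-combine m (λ i → f (n ↑ʳ i))))

-- Pointwise equal maps need not be propositionally equal, so a summand has to respect `≗` before
-- its sum can be reindexed.
Extensional : ∀ {n p} → ((Fin p → Fin n) → ℤ) → Set
Extensional f = ∀ {φ ψ} → φ ≗ ψ → f φ ≡ f ψ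

∷-cong : ∀ {n p} (x : Fin n) {φ ψ : Fin p → Fin n} → φ ≗ ψ → (x Vector.∷ φ) ≗ (x Vector.∷ ψ)
∷-cong x φ≗ψ zero    = refl
∷-cong x φ≗ψ (suc i) = φ≗ψ i

-- The values are chosen one at a time, so that decompositions of the domain or codomain become
-- inductions on `p`.
sumMaps : ∀ {n} p → ((Fin p → Fin n) → ℤ) → ℤ
sumMaps         zero    f = f Vector.[]
sumMaps {n = n} (suc p) f = ∑[ x < n ] sumMaps p (λ φ → f (x Vector.∷ φ))

sumMaps-cong : ∀ {n} p {f g : (Fin p → Fin n) → ℤ} → f ≗ g → sumMaps p f ≡ sumMaps p g
sumMaps-cong zero    f≗g = f≗g Vector.[]
sumMaps-cong (suc p) f≗g = sum-cong-≗ λ x → sumMaps-cong p λ φ → f≗g (x Vector.∷ φ)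

-- `finToFun` reads its index in base `n` with the value at `zero` as leading digit; `combine`
-- splits off that digit.
sum-finToFun : ∀ {n} p (f : (Fin p → Fin n) → ℤ) → Extensional f →
  ∑[ i < n ℕ.^ p ] f (finToFun i) ≡ sumMaps p f
sum-finToFun zero f ext =
  trans (ℤ.+-identityʳ (f (finToFun {n = 0} zero))) (ext λ ())
sum-finToFun {n} (suc p) f ext = begin
  ∑[ i < n ℕ.* n ℕ.^ p ] f (finToFun i)
    ≡⟨ sum-combine n {n ℕ.^ p} (λ i → f (finToFun i)) ⟩
  ∑[ x < n ] ∑[ i < n ℕ.^ p ] f (finToFun (combine x i))
    ≡⟨ sum-cong-≗ (λ x → sum-cong-≗ λ i → ext (finToFun-combine x i)) ⟩
  ∑[ x < n ] ∑[ i < n ℕ.^ p ] f (x Vector.∷ finToFun i)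
    ≡⟨ sum-cong-≗ (λ x → sum-finToFun p (λ φ → f (x Vector.∷ φ)) (ext ∘ ∷-cong x)) ⟩
  sumMaps (suc p) f ∎
  where
  finToFun-combine : ∀ x i → finToFun (combine x i) ≗ x Vector.∷ finToFun {m = n} {n = p} i
  finToFun-combine x i zero    = cong proj₁ (remQuot-combine x i)
  finToFun-combine x i (suc j) = cong (λ r → finToFun (proj₂ r) j) (remQuot-combine x i)

sumMaps-++ : ∀ {n} p {q} (f : (Fin (p ℕ.+ q) → Fin n) → ℤ) → Extensional f →
  sumMaps (p ℕ.+ q) f ≡ sumMaps p λ φ → sumMaps q λ ψ → f (φ ++ ψ)
sumMaps-++ zero    {q} f ext = sumMaps-cong q λ ψ → ext λ _ → refl
sumMaps-++ (suc p) {q} f ext = sum-cong-≗ λ x → trans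
  (sumMaps-++ p (λ φ → f (x Vector.∷ φ)) (ext ∘ ∷-cong x))
  (sumMaps-cong p λ φ → sumMaps-cong q λ ψ → ext (∷-++ x φ ψ))
  where
  ∷-++ : ∀ {n} (x : Fin n) (φ : Fin p → Fin n) (ψ : Fin q → Fin n) → x Vector.∷ (φ ++ ψ) ≗ (x Vector.∷ φ) ++ ψ
  ∷-++ x φ ψ zero = refl
  ∷-++ x φ ψ (suc i) with splitAt p i
  ... | inj₁ _ = refl
  ... | inj₂ _ = refl

sumMaps-*ˡ : ∀ {n} p a (f : (Fin p → Fin n) → ℤ) → sumMaps p (λ φ → a * f φ) ≡ a * sumMaps p f
sumMaps-*ˡ zero    a f = refl
sumMaps-*ˡ (suc p) a f = trans
  (sum-cong-≗ λ x → sumMaps-*ˡ p a (λ φ → f (x Vector.∷ φ)))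
  (sym (*-distribˡ-sum a (λ x → sumMaps p (λ φ → f (x Vector.∷ φ)))))

sumMaps-*ʳ : ∀ {n} p a (f : (Fin p → Fin n) → ℤ) → sumMaps p (λ φ → f φ * a) ≡ sumMaps p f * a
sumMaps-*ʳ p a f = begin
  sumMaps p (λ φ → f φ * a)  ≡⟨ sumMaps-cong p (λ φ → ℤ.*-comm (f φ) a) ⟩
  sumMaps p (λ φ → a * f φ)  ≡⟨ sumMaps-*ˡ p a f ⟩
  a * sumMaps p f            ≡⟨ ℤ.*-comm a (sumMaps p f) ⟩
  sumMaps p f * a            ∎

sumMaps-∑ : ∀ {n} p {k} (f : (Fin p → Fin n) → Fin k → ℤ) →
  sumMaps p (λ φ → ∑[ y < k ] f φ y) ≡ ∑[ y < k ] sumMaps p (λ φ → f φ y)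
sumMaps-∑ zero    f = refl
sumMaps-∑ (suc p) f = trans
  (sum-cong-≗ λ x → sumMaps-∑ p (λ φ → f (x Vector.∷ φ)))
  (∑-comm (λ x y → sumMaps p (λ φ → f (x Vector.∷ φ) y)))

sumMaps-combine : ∀ m n p (f : (Fin p → Fin (m ℕ.* n)) → ℤ) → Extensional f →
  sumMaps p f ≡ sumMaps {m} p λ φ → sumMaps {n} p λ ψ → f (λ i → combine (φ i) (ψ i))
sumMaps-combine m n zero    f ext = ext λ ()
sumMaps-combine m n (suc p) f ext = begin
  ∑[ z < m ℕ.* n ] sumMaps p (λ χ → f (z Vector.∷ χ))
    ≡⟨ sum-combine m (λ z → sumMaps p (λ χ → f (z Vector.∷ χ))) ⟩
  ∑[ x < m ] ∑[ y < n ] sumMaps p (λ χ → f (combine x y Vector.∷ χ))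
    ≡⟨ sum-cong-≗ (λ x → sum-cong-≗ λ y → trans
         (sumMaps-combine m n p (λ χ → f (combine x y Vector.∷ χ)) (ext ∘ ∷-cong (combine x y)))
         (sumMaps-cong p λ φ → sumMaps-cong p λ ψ → ext (∷-combine x y φ ψ))) ⟩
  ∑[ x < m ] ∑[ y < n ] sumMaps p (λ φ → sumMaps p λ ψ → f (zip (x Vector.∷ φ) (y Vector.∷ ψ)))
    ≡⟨ sum-cong-≗ (λ x → sumMaps-∑ p (λ φ y → sumMaps p λ ψ → f (zip (x Vector.∷ φ) (y Vector.∷ ψ)))) ⟨
  sumMaps (suc p) (λ φ → sumMaps (suc p) λ ψ → f (zip φ ψ)) ∎
  where
  zip : ∀ {q} → (Fin q → Fin m) → (Fin q → Fin n) → Fin q → Fin (m ℕ.* n)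
  zip φ ψ i = combine (φ i) (ψ i)

  ∷-combine : ∀ x y φ ψ → combine x y Vector.∷ zip φ ψ ≗ zip (x Vector.∷ φ) (y Vector.∷ ψ)
  ∷-combine x y φ ψ zero    = refl
  ∷-combine x y φ ψ (suc i) = refl

window-sumMaps : ∀ {N n} (c : Fin N → ℤ) p (f : (Fin p → Fin n) → ℕ → ℤ) k →
  window c (λ m → sumMaps p (λ φ → f φ m)) k ≡ sumMaps p (λ φ → window c (f φ) k)
window-sumMaps c zero    f k = refl
window-sumMaps c (suc p) f k = trans
  (window-sum c (λ x m → sumMaps p (λ φ → f (x Vector.∷ φ) m)) k)
  (sum-cong-≗ λ x → window-sumMaps c p (λ φ → f (x Vector.∷ φ)) k)

isHom-cong : ∀ F G {φ ψ : Vertex F → Vertex G} → φ ≗ ψ → IsHom F G φ → IsHom F G ψ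
isHom-cong F G φ≗ψ φ-hom u v u~v = subst₂ (Graph._~_ G) (φ≗ψ u) (φ≗ψ v) (φ-hom u v u~v)

hom-extensional : ∀ F G → Extensional (λ φ → indicator (isHom? F G φ))
hom-extensional F G φ≗ψ = indicator-cong (isHom? F G _) (isHom? F G _)
  (isHom-cong F G φ≗ψ) (isHom-cong F G (sym ∘ φ≗ψ))

hom-sum : ∀ F G → + hom F G ≡ sumMaps (order F) (λ φ → indicator (isHom? F G φ))
hom-sum F G = trans
  (count-sum (isHom? F G ∘ finToFun) id)
  (sum-finToFun (order F) (λ φ → indicator (isHom? F G φ)) (hom-extensional F G))

-- A map into the product is a pair of maps, and it is a homomorphism exactly when both are; the
-- indicator and hence the double sum factorise.
hom-⊗ : ∀ F G K → hom F (G ⊗ K) ≡ hom F G ℕ.* hom F K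
hom-⊗ F G K = ℤ.+-injective (begin
  + hom F (G ⊗ K)
    ≡⟨ hom-sum F (G ⊗ K) ⟩
  sumMaps p (λ χ → indicator (isHom? F (G ⊗ K) χ))
    ≡⟨ sumMaps-combine (order G) (order K) p (λ χ → indicator (isHom? F (G ⊗ K) χ))
         (hom-extensional F (G ⊗ K)) ⟩
  sumMaps p (λ φ → sumMaps p λ ψ → indicator (isHom? F (G ⊗ K) λ i → combine (φ i) (ψ i)))
    ≡⟨ sumMaps-cong p (λ φ → sumMaps-cong p λ ψ → split φ ψ) ⟩
  sumMaps p (λ φ → sumMaps p λ ψ → f φ * g ψ)
    ≡⟨ sumMaps-cong p (λ φ → sumMaps-*ˡ p (f φ) g) ⟩
  sumMaps p (λ φ → f φ * sumMaps p g)
    ≡⟨ sumMaps-*ʳ p (sumMaps p g) f ⟩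
  sumMaps p f * sumMaps p g
    ≡⟨ cong₂ _*_ (hom-sum F G) (hom-sum F K) ⟨
  + hom F G * + hom F K
    ≡⟨ ℤ.pos-* (hom F G) (hom F K) ⟨
  + (hom F G ℕ.* hom F K) ∎)
  where
  p = order F
  f : (Vertex F → Vertex G) → ℤ
  f φ = indicator (isHom? F G φ)
  g : (Vertex F → Vertex K) → ℤ
  g ψ = indicator (isHom? F K ψ)

  split : ∀ φ ψ → indicator (isHom? F (G ⊗ K) λ i → combine (φ i) (ψ i)) ≡ f φ * g ψ
  split φ ψ = trans
    (indicator-cong (isHom? F (G ⊗ K) (λ i → combine (φ i) (ψ i))) (isHom? F G φ ×-dec isHom? F K ψ)
      (λ χ-hom → (λ u v u~v → proj₁ (edge⇒ u v (χ-hom u v u~v)))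
               , (λ u v u~v → proj₂ (edge⇒ u v (χ-hom u v u~v))))
      (λ (φ-hom , ψ-hom) u v u~v → edge⇐ u v (φ-hom u v u~v , ψ-hom u v u~v)))
    (indicator-× (isHom? F G φ) (isHom? F K ψ))
    where
    Edge : Fin (order G) × Fin (order K) → Fin (order G) × Fin (order K) → Set
    Edge (x , y) (x′ , y′) = Graph._~_ G x x′ × Graph._~_ K y y′

    edge⇒ : ∀ u v → Graph._~_ (G ⊗ K) (combine (φ u) (ψ u)) (combine (φ v) (ψ v)) →
      Edge (φ u , ψ u) (φ v , ψ v)
    edge⇒ u v = subst₂ Edge (remQuot-combine (φ u) (ψ u)) (remQuot-combine (φ v) (ψ v))

    edge⇐ : ∀ u v → Edge (φ u , ψ u) (φ v , ψ v) →
      Graph._~_ (G ⊗ K) (combine (φ u) (ψ u)) (combine (φ v) (ψ v))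
    edge⇐ u v = subst₂ Edge (sym (remQuot-combine (φ u) (ψ u))) (sym (remQuot-combine (φ v) (ψ v)))

-- Walks and powers of the adjacency matrix

module _ (G : Graph) where
  open Graph G using (_~_; _~?_; ~-sym)

  adjacency : Vertex G → Vertex G → ℤ
  adjacency x y = indicator (x ~? y)

  adjacency-sym : ∀ x y → adjacency x y ≡ adjacency y x
  adjacency-sym x y = indicator-cong (x ~? y) (y ~? x) ~-sym ~-sym

  -- The values of `ψ` are the inner vertices of a walk from `x` to `y`, which thus has length
  -- `suc n`.
  Joined : ∀ {n} → Vertex G → Vertex G → (Fin n → Vertex G) → Set
  Joined {zero}  x y ψ = x ~ y
  Joined {suc n} x y ψ = x ~ ψ zero × Joined (ψ zero) y (tail ψ)

  joined? : ∀ {n} x y (ψ : Fin n → Vertex G) → Dec (Joined x y ψ)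
  joined? {zero}  x y ψ = x ~? y
  joined? {suc n} x y ψ = (x ~? ψ zero) ×-dec joined? (ψ zero) y (tail ψ)

  -- Splitting off the first step of the walk matches the recursion of `power`.
  count-walks : ∀ n x y → sumMaps n (λ ψ → indicator (joined? x y ψ)) ≡ power adjacency (suc n) x y
  count-walks zero    x y = sym (sum-δ (adjacency x) y)
  count-walks (suc n) x y = sum-cong-≗ λ z → begin
    sumMaps n (λ ψ → indicator ((x ~? z) ×-dec joined? z y ψ))
      ≡⟨ sumMaps-cong n (λ ψ → indicator-× (x ~? z) (joined? z y ψ)) ⟩
    sumMaps n (λ ψ → adjacency x z * indicator (joined? z y ψ))
      ≡⟨ sumMaps-*ˡ n (adjacency x z) (λ ψ → indicator (joined? z y ψ)) ⟩
    adjacency x z * sumMaps n (λ ψ → indicator (joined? z y ψ))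
      ≡⟨ cong (adjacency x z *_) (count-walks n z y) ⟩
    adjacency x z * power adjacency (suc n) z y ∎

  -- With the two lemmas below, this links the recursive `Joined` to `SubdivisionEdge`, which
  -- describes the path by its ends and by consecutive positions.
  joined⁺ : ∀ {m x y} (ψ : Fin (suc m) → Vertex G) → x ~ ψ zero → ψ (fromℕ m) ~ y →
    (∀ i j → toℕ j ≡ suc (toℕ i) → ψ i ~ ψ j) → Joined x y ψ
  joined⁺ {zero}  ψ first last step = first , last
  joined⁺ {suc m} ψ first last step = first ,
    joined⁺ (tail ψ) (step zero (suc zero) refl) last λ i j e → step (suc i) (suc j) (cong suc e)

  joined-last : ∀ {m x y} (ψ : Fin (suc m) → Vertex G) → Joined x y ψ → ψ (fromℕ m) ~ y
  joined-last {zero}  ψ (_ , last) = last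
  joined-last {suc m} ψ (_ , rest) = joined-last (tail ψ) rest

  joined-step : ∀ {m x y} (ψ : Fin (suc m) → Vertex G) → Joined x y ψ →
    ∀ i j → toℕ j ≡ suc (toℕ i) → ψ i ~ ψ j
  joined-step {suc m} ψ (_ , next , _) zero    (suc zero) _ = next
  joined-step {suc m} ψ (_ , rest)     (suc i) (suc j)    e =
    joined-step (tail ψ) rest i j (ℕ.suc-injective e)

-- Homomorphism counts of subdivisions

-- The part common to `F` and all subdivisions of `uv`. Adjacency is written as in `SubdivisionEdge`
-- between old vertices, so that proofs carry over unchanged.
deleteEdge : (F : Graph) (u v : Vertex F) → Graph
deleteEdge F u v = record
  { order = order F
  ; _~_   = λ a b → a ~ b × ¬ (a ≡ u × b ≡ v) × ¬ (b ≡ u × a ≡ v)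
  ; ~-sym = λ (a~b , p , q) → ~-sym a~b , q , p
  ; _~?_  = λ a b → (a ~? b) ×-dec ¬? (a ≟ u ×-dec b ≟ v) ×-dec ¬? (b ≟ u ×-dec a ≟ v)
  }
  where open Graph F using (_~_; ~-sym; _~?_)

module _ (F G : Graph) (u v : Vertex F) where
  private
    module F = Graph F
    module G = Graph G
    F∖e = deleteEdge F u v

  isHom-undelete : u F.~ v → ∀ φ → IsHom F∖e G φ → φ u G.~ φ v → IsHom F G φ
  isHom-undelete u~v φ φ-hom φu~φv a b a~b
    with a ≟ u ×-dec b ≟ v | b ≟ u ×-dec a ≟ v
  ... | yes (refl , refl) | _                 = φu~φv
  ... | no _              | yes (refl , refl) = G.~-sym φu~φv
  ... | no ab≢uv          | no ba≢uv          = φ-hom a b (a~b , ab≢uv , ba≢uv)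

  isHom-delete : ∀ φ → IsHom F G φ → IsHom F∖e G φ
  isHom-delete φ φ-hom a b (a~b , _) = φ-hom a b a~b

  -- Path edges are preserved because `ψ` is a walk; the inherited edges are handed back to the
  -- caller, since `φ` is not assumed to preserve them.
  subdivision-edge : ∀ m (φ : F.Vertex → G.Vertex) (ψ : Fin (suc m) → G.Vertex) →
    Joined G (φ u) (φ v) ψ → ∀ s t → SubdivisionEdge F u v m s t →
    [ φ , ψ ]′ s G.~ [ φ , ψ ]′ t ⊎
    ∃₂ λ a b → s ≡ inj₁ a × t ≡ inj₁ b × Graph._~_ F∖e a b
  subdivision-edge m φ ψ ψ-walk = edge
    where
    end : ∀ a i → PathEnd F u v m a i → φ a G.~ ψ i
    end a i (inj₁ (refl , refl)) = proj₁ ψ-walk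
    end a i (inj₂ (refl , refl)) = G.~-sym (joined-last G ψ ψ-walk)

    edge : ∀ s t → SubdivisionEdge F u v m s t → _
    edge (inj₁ a) (inj₁ b) e        = inj₂ (a , b , refl , refl , e)
    edge (inj₁ a) (inj₂ j) e        = inj₁ (end a j e)
    edge (inj₂ i) (inj₁ b) e        = inj₁ (G.~-sym (end b i e))
    edge (inj₂ i) (inj₂ j) (inj₁ e) = inj₁ (joined-step G ψ ψ-walk i j e)
    edge (inj₂ i) (inj₂ j) (inj₂ e) = inj₁ (G.~-sym (joined-step G ψ ψ-walk j i e))

  isHom-subdivide⁺ : ∀ m φ (ψ : Fin (suc m) → G.Vertex) →
    IsHom F∖e G φ → Joined G (φ u) (φ v) ψ → IsHom (subdivide F u v m) G (φ ++ ψ)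
  isHom-subdivide⁺ m φ ψ φ-hom ψ-walk x y xy
    with splitAt (order F) x | splitAt (order F) y
       | subdivision-edge m φ ψ ψ-walk (splitAt (order F) x) (splitAt (order F) y) xy
  ... | _ | _ | inj₁ e                          = e
  ... | _ | _ | inj₂ (a , b , refl , refl , ab) = φ-hom a b ab

  isHom-subdivide⁻ : ∀ m φ (ψ : Fin (suc m) → G.Vertex) →
    IsHom (subdivide F u v m) G (φ ++ ψ) → IsHom F∖e G φ × Joined G (φ u) (φ v) ψ
  isHom-subdivide⁻ m φ ψ χ-hom =
    (λ a b → edge (inj₁ a) (inj₁ b)) ,
    joined⁺ G ψ
      (edge (inj₁ u) (inj₂ zero) (inj₁ (refl , refl)))
      (edge (inj₂ (fromℕ m)) (inj₁ v) (inj₂ (refl , refl)))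
      (λ i j e → edge (inj₂ i) (inj₂ j) (inj₁ e))
    where
    edge : ∀ s t → SubdivisionEdge F u v m s t → [ φ , ψ ]′ s G.~ [ φ , ψ ]′ t
    edge s t e with χ-hom (join (order F) (suc m) s) (join (order F) (suc m) t)
    ... | h rewrite splitAt-join (order F) (suc m) s | splitAt-join (order F) (suc m) t = h e

  -- The count for a path with `n` inner vertices in place of `uv`, as a linear functional of the
  -- power `suc n`; `n = 0` stands for `F` itself.
  subdivisionCount : ℕ → ℤ
  subdivisionCount n = sumMaps (order F) λ φ →
    indicator (isHom? F∖e G φ) * power (adjacency G) (suc n) (φ u) (φ v)

  hom-unsubdivided : u F.~ v → + hom F G ≡ subdivisionCount 0
  hom-unsubdivided u~v = trans (hom-sum F G) (sumMaps-cong (order F) λ φ → begin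
    indicator (isHom? F G φ)
      ≡⟨ indicator-cong (isHom? F G φ) (isHom? F∖e G φ ×-dec (φ u G.~? φ v))
           (λ φ-hom → isHom-delete φ φ-hom , φ-hom u v u~v)
           (λ (φ-hom , φu~φv) → isHom-undelete u~v φ φ-hom φu~φv) ⟩
    indicator (isHom? F∖e G φ ×-dec (φ u G.~? φ v))
      ≡⟨ indicator-× (isHom? F∖e G φ) (φ u G.~? φ v) ⟩
    indicator (isHom? F∖e G φ) * adjacency G (φ u) (φ v)
      ≡⟨ cong (indicator (isHom? F∖e G φ) *_) (count-walks G 0 (φ u) (φ v)) ⟩
    indicator (isHom? F∖e G φ) * power (adjacency G) 1 (φ u) (φ v) ∎)

  -- A homomorphism amounts to one from `F∖e` with a walk between the images of `u` and `v`. The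
  -- parameter `m` means `suc m` inner vertices, hence the shift.
  hom-subdivide : ∀ m → + hom (subdivide F u v m) G ≡ subdivisionCount (suc m)
  hom-subdivide m = begin
    + hom Fₘ G
      ≡⟨ hom-sum Fₘ G ⟩
    sumMaps (order F ℕ.+ suc m) (λ χ → indicator (isHom? Fₘ G χ))
      ≡⟨ sumMaps-++ (order F) (λ χ → indicator (isHom? Fₘ G χ)) (hom-extensional Fₘ G) ⟩
    sumMaps (order F) (λ φ → sumMaps (suc m) λ ψ → indicator (isHom? Fₘ G (φ ++ ψ)))
      ≡⟨ sumMaps-cong (order F) (λ φ → trans (sumMaps-cong (suc m) (split φ)) (trans
           (sumMaps-*ˡ (suc m) (indicator (isHom? F∖e G φ)) (λ ψ → indicator (joined? G (φ u) (φ v) ψ)))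
           (cong (indicator (isHom? F∖e G φ) *_) (count-walks G (suc m) (φ u) (φ v))))) ⟩
    subdivisionCount (suc m) ∎
    where
    Fₘ = subdivide F u v m

    split : ∀ φ (ψ : Fin (suc m) → G.Vertex) → indicator (isHom? Fₘ G (φ ++ ψ)) ≡
      indicator (isHom? F∖e G φ) * indicator (joined? G (φ u) (φ v) ψ)
    split φ ψ = trans
      (indicator-cong (isHom? Fₘ G (φ ++ ψ)) (isHom? F∖e G φ ×-dec joined? G (φ u) (φ v) ψ)
        (isHom-subdivide⁻ m φ ψ)
        (λ (φ-hom , ψ-walk) → isHom-subdivide⁺ m φ ψ φ-hom ψ-walk))
      (indicator-× (isHom? F∖e G φ) (joined? G (φ u) (φ v) ψ))

  subdivisionCount-recurrence : ∀ {N} (c : Fin N → ℤ) →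
    (∀ k x y → window c (λ m → power (adjacency G) (suc m) x y) k ≡ 0ℤ) →
    ∀ k → window c subdivisionCount k ≡ 0ℤ
  subdivisionCount-recurrence c rel k = begin
    window c subdivisionCount k
      ≡⟨ window-sumMaps c (order F) (λ φ n → e φ * w φ n) k ⟩
    sumMaps (order F) (λ φ → window c (λ n → e φ * w φ n) k)
      ≡⟨ sumMaps-cong (order F) (λ φ → trans (window-* c (e φ) (w φ) k)
           (cong (e φ *_) (rel k (φ u) (φ v)))) ⟩
    sumMaps (order F) (λ φ → e φ * 0ℤ)
      ≡⟨ sumMaps-*ʳ (order F) 0ℤ e ⟩
    sumMaps (order F) e * 0ℤ
      ≡⟨ ℤ.*-zeroʳ (sumMaps (order F) e) ⟩
    0ℤ ∎
    where
    e : (F.Vertex → G.Vertex) → ℤ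
    e φ = indicator (isHom? F∖e G φ)
    w : (F.Vertex → G.Vertex) → ℕ → ℤ
    w φ n = power (adjacency G) (suc n) (φ u) (φ v)

subdivisions-determine-hom : ∀ F u v → Graph._~_ F u v → ∀ G H N →
  (∀ m → hom (subdivide F u v (m ℕ.+ N)) G ≡ hom (subdivide F u v (m ℕ.+ N)) H) →
  hom F G ≡ hom F H
subdivisions-determine-hom F u v u~v G H N agree =
  let _ , c , c₀≢0 , G-rel , H-rel = common-recurrence (adjacency G) (adjacency H)
        (adjacency-sym G) (adjacency-sym H)
  in ℤ.+-injective (begin
    + hom F G
      ≡⟨ hom-unsubdivided F G u v u~v ⟩
    subdivisionCount F G u v 0
      ≡⟨ recurrence-backwards c c₀≢0 (subdivisionCount F G u v) (subdivisionCount F H u v)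
           (λ k → trans (subdivisionCount-recurrence F G u v c G-rel k)
             (sym (subdivisionCount-recurrence F H u v c H-rel k)))
           -- Parameter `m + N` of `subdivide` is index `suc (m + N)` of the count, so agreement
           -- starts at `suc N`.
           (suc N) eventually ⟩
    subdivisionCount F H u v 0
      ≡⟨ hom-unsubdivided F H u v u~v ⟨
    + hom F H ∎)
  where
  eventually : ∀ m → subdivisionCount F G u v (m ℕ.+ suc N) ≡ subdivisionCount F H u v (m ℕ.+ suc N)
  eventually m rewrite ℕ.+-suc m N = begin
    subdivisionCount F G u v (suc (m ℕ.+ N))  ≡⟨ hom-subdivide F G u v (m ℕ.+ N) ⟨
    + hom (subdivide F u v (m ℕ.+ N)) G       ≡⟨ cong +_ (agree m) ⟩
    + hom (subdivide F u v (m ℕ.+ N)) H       ≡⟨ hom-subdivide F H u v (m ℕ.+ N) ⟩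
    subdivisionCount F H u v (suc (m ℕ.+ N))  ∎

-- Closed walks in non-bipartite graphs

odd : ℕ → Bool
odd zero    = false
odd (suc n) = not (odd n)

odd-+ : ∀ m n → odd (m ℕ.+ n) ≡ odd m xor odd n
odd-+ zero    n = refl
odd-+ (suc m) n = trans (cong not (odd-+ m n)) (Bool.not-distribˡ-xor (odd m) (odd n))

module _ (K : Graph) where
  open Graph K using (_~_)

  data Walk : ℕ → Vertex K → Vertex K → Set where
    nil  : ∀ {x} → Walk 0 x x
    cons : ∀ {n x y z} → x ~ y → Walk n y z → Walk (suc n) x z

  OddClosedWalk : Set
  OddClosedWalk = ∃₂ λ x n → Walk n x x × odd n ≡ true

  -- A spanning forest of the edges in es, with its 2-colouring.
  record Colouring (es : List (Vertex K × Vertex K)) : Set where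
    field
      root   : Vertex K → Vertex K
      side   : Vertex K → Bool
      toRoot : ∀ v → ∃ λ n → Walk n v (root v) × odd n ≡ side v
      proper : ∀ {a b} → (a , b) ∈ es → a ~ b → root a ≡ root b × side a ≢ side b

module _ {K : Graph} where
  open Graph K using (_~_; _~?_; ~-sym)

  append : ∀ {m n x y z} → Walk K m x y → Walk K n y z → Walk K (m ℕ.+ n) x z
  append nil        w = w
  append (cons e v) w = cons e (append v w)

  reverse : ∀ {n x y} → Walk K n x y → Walk K n y x
  reverse nil                = nil
  reverse {x = x} {y = y} (cons {n = n} e w) = subst (λ m → Walk K m y x) (ℕ.+-comm n 1)
    (append (reverse w) (cons (~-sym e) nil))

  -- Inside a component the edge is properly coloured or closes an odd walk. Between components,
  -- that of `a` moves to the root of `b` and its colours are shifted.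
  insertEdge : ∀ {a b es} → a ~ b → Colouring K es → OddClosedWalk K ⊎ Colouring K ((a , b) ∷ es)
  insertEdge {a} {b} {es} a~b C with Colouring.root C a ≟ Colouring.root C b
                                   | Colouring.side C a Bool.≟ Colouring.side C b
  -- From `a` to the common root, on to `b`, and back along the edge: equal sides cancel and the
  -- edge makes the length odd.
  ... | yes same | yes sides≡ =
    let nₐ , wₐ , oddₐ = toRoot a
        n_b , w_b , odd_b = toRoot b
    in inj₁ (a , nₐ ℕ.+ (n_b ℕ.+ 1) ,
         append wₐ (append (subst (λ r → Walk K n_b r b) (sym same) (reverse w_b))
           (cons (~-sym a~b) nil)) ,
         (begin
           odd (nₐ ℕ.+ (n_b ℕ.+ 1))           ≡⟨ odd-+ nₐ (n_b ℕ.+ 1) ⟩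
           odd nₐ xor odd (n_b ℕ.+ 1)         ≡⟨ cong (odd nₐ xor_) (odd-+ n_b 1) ⟩
           odd nₐ xor (odd n_b xor true)      ≡⟨ cong₂ (λ s t → s xor (t xor true)) oddₐ (trans odd_b (sym sides≡)) ⟩
           side a xor (side a xor true)       ≡⟨ Bool.xor-assoc (side a) (side a) true ⟨
           (side a xor side a) xor true       ≡⟨ cong (_xor true) (Bool.xor-same (side a)) ⟩
           true                               ∎))
    where open Colouring C
  ... | yes same | no sides≢ = inj₂ record
    { root   = root
    ; side   = side
    ; toRoot = toRoot
    ; proper = λ where
        (here refl) _  → same , sides≢
        (there e∈)     → proper e∈
    }
    where open Colouring C
  ... | no distinct | _ = inj₂ record
    { root   = root′
    ; side   = side′
    ; toRoot = toRoot′
    ; proper = λ where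
        (here refl) _    → proper-new
        (there e∈)  c~d  → proper-old (proper e∈ c~d)
    }
    where
    open Colouring C
    -- Parity of the walk from the root of `a` via the new edge to the root of `b`.
    shift = side a xor not (side b)

    root′ : Vertex K → Vertex K
    root′ v with root v ≟ root a
    ... | yes _ = root b
    ... | no  _ = root v

    side′ : Vertex K → Bool
    side′ v with root v ≟ root a
    ... | yes _ = side v xor shift
    ... | no  _ = side v

    toRoot′ : ∀ v → ∃ λ n → Walk K n v (root′ v) × odd n ≡ side′ v
    toRoot′ v with root v ≟ root a
    ... | no _ = toRoot v
    ... | yes same =
      let nᵥ , wᵥ , oddᵥ = toRoot v
          nₐ , wₐ , oddₐ = toRoot a
          n_b , w_b , odd_b = toRoot b
      in nᵥ ℕ.+ (nₐ ℕ.+ suc n_b) ,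
         append wᵥ (append (subst (λ r → Walk K nₐ r a) (sym same) (reverse wₐ)) (cons a~b w_b)) ,
         trans (odd-+ nᵥ (nₐ ℕ.+ suc n_b)) (cong₂ _xor_ oddᵥ
           (trans (odd-+ nₐ (suc n_b)) (cong₂ _xor_ oddₐ (cong not odd_b))))

    proper-new : root′ a ≡ root′ b × side′ a ≢ side′ b
    proper-new with root a ≟ root a | root b ≟ root a
    ... | no a≢a | _       = contradiction refl a≢a
    ... | yes _  | yes b≡a = contradiction (sym b≡a) distinct
    ... | yes _  | no _    = refl , flipped (side a) (side b)
      where
      flipped : ∀ s t → s xor (s xor not t) ≢ t
      flipped true  true  ()
      flipped true  false ()
      flipped false true  ()
      flipped false false ()

    proper-old : ∀ {c d} → root c ≡ root d × side c ≢ side d → root′ c ≡ root′ d × side′ c ≢ side′ d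
    proper-old {c} {d} (c≡d , sides≢) with root c ≟ root a | root d ≟ root a
    ... | yes _   | yes _   = refl , λ eq → sides≢ (xor-cancelʳ (side c) (side d) shift eq)
      where
      xor-cancelʳ : ∀ s t r → s xor r ≡ t xor r → s ≡ t
      xor-cancelʳ true  true  _ _ = refl
      xor-cancelʳ false false _ _ = refl
      xor-cancelʳ true  false r e = contradiction (sym e) (Bool.not-¬ refl)
      xor-cancelʳ false true  r e = contradiction e (Bool.not-¬ refl)
    ... | no _    | no _    = c≡d , sides≢
    ... | yes c≡a | no d≢a  = contradiction (trans (sym c≡d) c≡a) d≢a
    ... | no c≢a  | yes d≡a = contradiction (trans c≡d d≡a) c≢a

  colour : ∀ es → OddClosedWalk K ⊎ Colouring K es
  colour [] = inj₂ record
    { root   = id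
    ; side   = λ _ → false
    ; toRoot = λ _ → 0 , nil , refl
    ; proper = λ ()
    }
  colour ((a , b) ∷ es) with colour es | a ~? b
  ... | inj₁ w | _       = inj₁ w
  ... | inj₂ C | yes a~b = insertEdge a~b C
  ... | inj₂ C | no  a≁b = inj₂ record
    { root   = root
    ; side   = side
    ; toRoot = toRoot
    ; proper = λ where
        (here refl) a~b → contradiction a~b a≁b
        (there e∈)      → proper e∈
    }
    where open Colouring C

  -- The list holds all pairs of vertices, so a colouring proper on it would be a bipartition.
  oddClosedWalk : ¬ Bipartite K → OddClosedWalk K
  oddClosedWalk nb with colour (cartesianProduct (allFin (order K)) (allFin (order K)))
  ... | inj₁ w = w
  ... | inj₂ C = contradiction
    (Colouring.side C , λ {u} {v} u~v →
      proj₂ (Colouring.proper C (∈-cartesianProduct⁺ (∈-allFin u) (∈-allFin v)) u~v))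
    nb

  evenClosedWalk : ∀ {x y} → x ~ y → ∀ n → odd n ≡ false → Walk K n x x
  evenClosedWalk x~y zero          _ = nil
  evenClosedWalk x~y (suc (suc n)) e = cons x~y (cons (~-sym x~y)
    (evenClosedWalk x~y n (trans (sym (Bool.not-involutive (odd n))) e)))

  -- Even `m` is filled by going back and forth along the first edge of `w`. For odd `m` the total
  -- length is even, and that edge alone serves.
  longClosedWalk : ∀ {n x} → Walk K n x x → odd n ≡ true → ∀ m → Walk K (m ℕ.+ n) x x
  longClosedWalk {n} {x} w@(cons x~y _) n-odd m = pad (odd m) refl
    where
    pad : ∀ p → odd m ≡ p → Walk K (m ℕ.+ n) x x
    pad false m-even = append (evenClosedWalk x~y m m-even) w
    pad true  m-odd  = evenClosedWalk x~y (m ℕ.+ n)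
      (trans (odd-+ m n) (cong₂ _xor_ m-odd n-odd))

  walk-joined : ∀ {n x y} → Walk K (suc n) x y → ∃ λ (ψ : Fin n → Vertex K) → Joined K x y ψ
  walk-joined {zero}  (cons x~y nil) = Vector.[] , x~y
  walk-joined {suc n} (cons x~z w)   = let ψ , ψ-walk = walk-joined w in _ Vector.∷ ψ , x~z , ψ-walk

-- Undoing the subdivisions, and cancellation

hom-positive : ∀ F K (f : Vertex F → Vertex K) → IsHom F K f → hom F K > 0
hom-positive F K f f-hom = ∈-length (∈-filter⁺ (isHom? F K ∘ finToFun) (∈-allFin (funToFin f))
  (isHom-cong F K (sym ∘ finToFun-funToFin f) f-hom))

module _ {ℓ} (𝓕 : Pred Graph ℓ) (closed : ClosedUnderSubdivisions 𝓕) (K : Graph)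
         {x : Vertex K} {N : ℕ} (w : Walk K N x x) (N-odd : odd N ≡ true)
         (G H : Graph) (agree : HomEquiv (𝓕 ↓ K) G H) where

  -- The edges in es are those that f need not preserve; their long subdivisions
  -- are routed along closed walks at x.
  hom-agree : ∀ F → 𝓕 F → (f : Vertex F → Vertex K) {l : ℕ} (es : Vec (Vertex F × Vertex F) l) →
    VecAll.All (λ (a , b) → f a ≡ x × f b ≡ x) es →
    (∀ a b → Graph._~_ F a b → Graph._~_ K (f a) (f b) ⊎ (a , b) ∈ᵛ es ⊎ (b , a) ∈ᵛ es) →
    hom F G ≡ hom F H
  hom-agree F F∈𝓕 f [] [] edge = agree F (F∈𝓕 , hom-positive F K f λ a b a~b → good (edge a b a~b))
    where
    good : ∀ {A : Set} {a b : Vertex F × Vertex F} → A ⊎ a ∈ᵛ [] ⊎ b ∈ᵛ [] → A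
    good (inj₁ e)         = e
    good (inj₂ (inj₁ ()))
    good (inj₂ (inj₂ ()))
  hom-agree F F∈𝓕 f ((u , v) ∷ es) ((fu≡x , fv≡x) ∷ es-at-x) edge with Graph._~?_ F u v
  ... | no u≁v = hom-agree F F∈𝓕 f es es-at-x λ a b a~b → drop a~b (edge a b a~b)
    where
    drop : ∀ {a b} → Graph._~_ F a b →
      Graph._~_ K (f a) (f b) ⊎ (a , b) ∈ᵛ (u , v) ∷ es ⊎ (b , a) ∈ᵛ (u , v) ∷ es →
      Graph._~_ K (f a) (f b) ⊎ (a , b) ∈ᵛ es ⊎ (b , a) ∈ᵛ es
    drop a~b (inj₁ e)                  = inj₁ e
    drop a~b (inj₂ (inj₁ (here refl))) = contradiction a~b u≁v
    drop a~b (inj₂ (inj₁ (there p)))   = inj₂ (inj₁ p)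
    drop a~b (inj₂ (inj₂ (here refl))) = contradiction (Graph.~-sym F a~b) u≁v
    drop a~b (inj₂ (inj₂ (there p)))   = inj₂ (inj₂ p)
  -- Each long subdivision of `uv` has its new path mapped along a closed walk at `x`, so only `es`
  -- remains and the induction applies to it.
  ... | yes u~v = subdivisions-determine-hom F u v u~v G H N subdivided
    where
    subdivided : ∀ m → hom (subdivide F u v (m ℕ.+ N)) G ≡ hom (subdivide F u v (m ℕ.+ N)) H
    subdivided m = hom-agree Fₘ (closed F F∈𝓕 u v u~v (m ℕ.+ N)) (f ++ ψ) (Vec.map inject es)
      (map⁺ (VecAll.map (λ (fa≡x , fb≡x) → trans (f++ψ _) fa≡x , trans (f++ψ _) fb≡x) es-at-x))
      edge′
      where
      Fₘ = subdivide F u v (m ℕ.+ N)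
      k = suc (m ℕ.+ N)

      ψ : Fin k → Vertex K
      -- The path has `k` inner vertices and so length `suc k`, which is `suc (suc m) + N`.
      ψ = proj₁ (walk-joined (longClosedWalk w N-odd (suc (suc m))))

      ψ-walk : Joined K (f u) (f v) ψ
      ψ-walk = subst₂ (λ y z → Joined K y z ψ) (sym fu≡x) (sym fv≡x)
        (proj₂ (walk-joined (longClosedWalk w N-odd (suc (suc m)))))

      inject : Vertex F × Vertex F → Vertex Fₘ × Vertex Fₘ
      inject (a , b) = a ↑ˡ k , b ↑ˡ k

      f++ψ : ∀ a → (f ++ ψ) (a ↑ˡ k) ≡ f a
      f++ψ a = cong [ f , ψ ]′ (splitAt-↑ˡ (order F) a k)

      inherit : ∀ a b → Graph._~_ (deleteEdge F u v) a b →
        Graph._~_ K ((f ++ ψ) (a ↑ˡ k)) ((f ++ ψ) (b ↑ˡ k)) ⊎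
        inject (a , b) ∈ᵛ Vec.map inject es ⊎ inject (b , a) ∈ᵛ Vec.map inject es
      -- The subdivision no longer contains `uv`, so the head of the list cannot account for an
      -- inherited edge.
      inherit a b (a~b , ab≢uv , ba≢uv) with edge a b a~b
      ... | inj₁ e                  = inj₁ (subst₂ (Graph._~_ K) (sym (f++ψ a)) (sym (f++ψ b)) e)
      ... | inj₂ (inj₁ (here refl)) = contradiction (refl , refl) ab≢uv
      ... | inj₂ (inj₁ (there p))   = inj₂ (inj₁ (∈ᵛ-map⁺ inject p))
      ... | inj₂ (inj₂ (here refl)) = contradiction (refl , refl) ba≢uv
      ... | inj₂ (inj₂ (there p))   = inj₂ (inj₂ (∈ᵛ-map⁺ inject p))

      edge′ : ∀ y z → Graph._~_ Fₘ y z →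
        Graph._~_ K ((f ++ ψ) y) ((f ++ ψ) z) ⊎ (y , z) ∈ᵛ Vec.map inject es ⊎ (z , y) ∈ᵛ Vec.map inject es
      edge′ y z y~z
        with subdivision-edge F K u v (m ℕ.+ N) f ψ ψ-walk
               (splitAt (order F) y) (splitAt (order F) z) y~z
      ... | inj₁ e = inj₁ e
      ... | inj₂ (a , b , y≡a , z≡b , a~b)
        with refl ← splitAt⁻¹-↑ˡ y≡a | refl ← splitAt⁻¹-↑ˡ z≡b = inherit a b a~b

-- The induction starts from the constant map to `x` with every pair of vertices listed, so no edge
-- has to be preserved. Loops in `G` and `H` are allowed, as cancellation requires.
homEquiv-↓ : ∀ {ℓ} (𝓕 : Pred Graph ℓ) → ClosedUnderSubdivisions 𝓕 → ∀ K → ¬ Bipartite K →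
  ∀ G H → HomEquiv (𝓕 ↓ K) G H → HomEquiv 𝓕 G H
homEquiv-↓ 𝓕 closed K nb G H agree F F∈𝓕 =
  let x , N , w , N-odd = oddClosedWalk nb
  in hom-agree 𝓕 closed K w N-odd G H agree F F∈𝓕 (λ _ → x)
       (Vec.fromList (cartesianProduct (allFin (order F)) (allFin (order F))))
       (VecAll.universal (λ _ → refl , refl) _)
       (λ a b _ → inj₂ (inj₁ (∈-fromList⁺ (∈-cartesianProduct⁺ (∈-allFin a) (∈-allFin b)))))

theorem43 : ∀ {ℓ : Level} (𝓕 : Pred Graph ℓ) →
    𝓕 ⊆ Simple →
    ClosedUnderSubdivisions 𝓕 →
    (∀ (K : Graph) → ¬ Bipartite K → 𝓕 ⊆ cl (𝓕 ↓ K)) ×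
    (∀ (K : Graph) → ¬ Bipartite K → AdmitsCancellation (HomEquiv 𝓕) K)
theorem43 𝓕 simple closed =
  (λ K nb {F} F∈𝓕 → simple F∈𝓕 , λ G H _ _ agree → homEquiv-↓ 𝓕 closed K nb G H agree F F∈𝓕) ,
  -- It suffices to compare counts from `F` with `hom F K > 0`, and for these the factor `hom F K`
  -- cancels.
  (λ K nb G H G⊗K≡H⊗K → homEquiv-↓ 𝓕 closed K nb G H λ F (F∈𝓕 , positive) →
    ℕ.*-cancelʳ-≡ (hom F G) (hom F H) (hom F K) {{ℕ.>-nonZero positive}} (begin
      hom F G ℕ.* hom F K  ≡⟨ hom-⊗ F G K ⟨
      hom F (G ⊗ K)        ≡⟨ G⊗K≡H⊗K F F∈𝓕 ⟩
      hom F (H ⊗ K)        ≡⟨ hom-⊗ F H K ⟩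
      hom F H ℕ.* hom F K  ∎))
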